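{- The random graph $\mathbf R$ is sociable.
   Context: A graph is a pair $G=(V,E)$ where $E$ is a symmetric and reflexive binary relation on $V$ (every vertex has a loop); $x,y$ are adjacent if $(x,y)\in E$. A graph homomorphism is an edge-preserving map (so it may collapse edges). An embedding is a one-to-one homomorphism $e$ such that $e(x),e(y)$ adjacent implies $x,y$ adjacent. Random graph: $\mathbf R$ is the unique (up to isomorphism) countable graph such that for all disjoint finite sets $A,B\subseteq\mathbf R$ there is a vertex in $\mathbf R\setminus(A\cup B)$ adjacent to all elements of $A$ and to no element of $B$. Sociable graphs: a transition from a finite nonempty graph $G$ to a graph $H$ is a pair $(e,p)$ where $e\colon G\to H$ is an embedding, $p\colon H\to G$ is a homomorphism, $p\circ e=\mathrm{id}_G$, and $H\setminus e[G]$ is either empty (trivial transition) or a single vertex $w$. It is a sociable transition if it is trivial or if the unique vertex $w\in H\setminus e[G]$ is adjacent to $e(p(w))$. A countable (finite or infinite) graph $W$ is sociable if it is obtained from the one-vertex graph $\Theta$ by a finite or infinite composition of sociable transitions; that is, (up to isomorphism) $W=\bigcup_{n\in\omega}G_n$ where $G_0\subseteq G_1\subseteq\dots$ are finite induced subgraphs, $|G_0|=1$, and for each $n$ the inclusion $G_n\subseteq G_{n+1}$ together with some homomorphism $p_n\colon G_{n+1}\to G_n$ is a sociable transition. -}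

module Defs where

open import Level using (0ℓ)
open import Data.Fin.Base using (Fin)
open import Data.List.Base using (List; _++_)
open import Data.List.Membership.Propositional using (_∈_; _∉_)
open import Data.List.Relation.Binary.Disjoint.Propositional using (Disjoint)
open import Data.Nat.Base using (ℕ; zero; suc)
open import Data.Product.Base using (Σ-syntax; ∃; ∃-syntax; _×_)
open import Data.Refinement.Base using (Refinement; refine; value)
open import Data.Sum.Base using (_⊎_)
open import Function.Bundles using (_↔_)
open import Function.Definitions using (Injective)
open import Relation.Binary.Core using (Rel; _Preserves_⟶_)
open import Relation.Binary.Definitions using (Reflexive; Symmetric)
open import Relation.Binary.PropositionalEquality.Core using (_≡_)
open import Relation.Nullary.Negation.Core using (¬_)
open import Relation.Unary as U using (Pred; ∁; _≐_; ｛_｝; Empty)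

record Graph : Set₁ where
  field
    Vertex : Set
    Adj    : Rel Vertex 0ℓ
    refl   : Reflexive Adj
    sym    : Symmetric Adj

open Graph public using (Vertex; Adj)

Finite : Set → Set
Finite A = ∃[ n ] (A ↔ Fin n)

Countable : Set → Set
Countable A = Finite A ⊎ (A ↔ ℕ)

-- The lists A and B stand for finite sets of vertices; repetitions are
-- harmless because only membership is used.
ExtensionProperty : Graph → Set
ExtensionProperty R =
  (A B : List (Vertex R)) → Disjoint A B →
  ∃[ z ] (z ∉ A ++ B
        × (∀ {a} → a ∈ A → Adj R z a)
        × (∀ {b} → b ∈ B → ¬ Adj R z b))

-- The random graph is determined by these two properties only up to
-- isomorphism, so it is treated as any graph having them.
record IsRandomGraph (R : Graph) : Set where
  field
    countable : Countable (Vertex R)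
    extension : ExtensionProperty R

module _ (G H : Graph) where

  IsHomomorphism : (Vertex G → Vertex H) → Set
  IsHomomorphism f = f Preserves Adj G ⟶ Adj H

  record IsEmbedding (e : Vertex G → Vertex H) : Set where
    field
      homomorphism : IsHomomorphism e
      injective    : Injective _≡_ _≡_ e
      reflects     : ∀ {x y} → Adj H (e x) (e y) → Adj G x y

Image : {A B : Set} → (A → B) → Pred B 0ℓ
Image f y = ∃[ x ] f x ≡ y

module _ (G H : Graph) (e : Vertex G → Vertex H) (p : Vertex H → Vertex G) where

  Trivial : Set
  Trivial = Empty (∁ (Image e))

  record IsTransition : Set where
    field
      finite       : Finite (Vertex G)
      nonempty     : Vertex G
      embedding    : IsEmbedding G H e
      homomorphism : IsHomomorphism H G p
      retraction   : ∀ x → p (e x) ≡ x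
      remainder    : Trivial ⊎ (∃[ w ] ∁ (Image e) ≐ ｛ w ｝)

  record IsSociableTransition : Set where
    field
      transition : IsTransition
      sociable   : Trivial ⊎
                   (∃[ w ] (∁ (Image e) ≐ ｛ w ｝ × Adj H w (e (p w))))

-- The induced subgraph on S.  Membership proofs in a Refinement are
-- irrelevant, so two of its vertices are equal as soon as they are equal
-- in W.
induced : (W : Graph) → Pred (Vertex W) 0ℓ → Graph
induced W S = record
  { Vertex = Refinement (Vertex W) S
  ; Adj    = λ x y → Adj W (value x) (value y)
  ; refl   = Graph.refl W
  ; sym    = Graph.sym W
  }

-- Each stage S n is finite and nonempty because, as the source of a
-- transition, the graph it induces is.
record Sociable (W : Graph) : Set₁ where
  field
    countable : Countable (Vertex W)
    S         : ℕ → Pred (Vertex W) 0ℓ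
    start     : ∃[ v ] S zero ≐ ｛ v ｝
    S⊆S       : ∀ n → S n U.⊆ S (suc n)
    step      : ∀ n →
                Σ[ p ∈ (Vertex (induced W (S (suc n))) →
                        Vertex (induced W (S n))) ]
                IsSociableTransition (induced W (S n)) (induced W (S (suc n)))
                                     (refine (S⊆S n)) p
    union     : ∀ v → ∃[ n ] v U.∈ S n

{-# OPTIONS --safe #-}
-- Keep every finite stage a cone, i.e. with an apex adjacent to all of its
-- vertices.  To absorb a given vertex r, first add a vertex z adjacent to the
-- whole stage and to r: it folds onto the old apex and is an apex of the new
-- stage.  Then r, being adjacent to z, folds onto z.  Absorbing the vertices
-- of an enumeration one after another exhausts the graph.  Adjacency is never
-- decided, only equality of vertices.
module Submission where

open import Defs

open import Data.Fin.Base using (Fin; zero; suc)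
open import Data.Irrelevant using ([_])
open import Data.List.Base using (List; []; _∷_; tabulate; length; lookup; deduplicate)
open import Data.List.Membership.Propositional using (_∈_; _∉_)
open import Data.List.Membership.Propositional.Properties
  using (∈-tabulate⁺; ∈-lookup; ∈-++⁺ˡ; ∈-deduplicate⁺; ∈-deduplicate⁻)
import Data.List.Membership.DecPropositional as DecMembership
import Data.List.Relation.Unary.All as All
open import Data.List.Relation.Unary.Any using (here; there; head; index)
open import Data.List.Relation.Unary.Any.Properties using (lookup-index)
open import Data.List.Relation.Unary.Unique.Propositional using (Unique; _∷_)
open import Data.List.Relation.Unary.Unique.DecPropositional.Properties using (deduplicate-!)
open import Data.Nat.Base using (ℕ; zero; suc; _+_; _*_)
open import Data.Nat.Properties using (+-suc; +-identityʳ) renaming (_≟_ to _≟ℕ_)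
open import Data.Product.Base using (∃; ∃-syntax; _×_; _,_; proj₂)
open import Data.Refinement.Base using (Refinement; refine; value; _,_)
open import Data.Refinement.Properties using (value-injective)
open import Data.Sum.Base using (_⊎_; inj₁; inj₂; map₂)
open import Function.Base using (_∘_; id)
open import Function.Bundles using (_↔_; mk↔ₛ′; Inverse)
open import Function.Properties.Inverse using (↔⇒↣)
open import Relation.Binary.Definitions using (DecidableEquality)
open import Relation.Binary.PropositionalEquality
  using (_≡_; refl; sym; trans; cong; subst)
open import Relation.Nullary using (¬_; yes; no; contradiction; recompute)
open import Relation.Nullary.Negation using (contradiction-irr)
open import Relation.Nullary.Decidable using (via-injection)
open import Relation.Unary using (∁; _≐_; ｛_｝)

lookup-injective : {A : Set} {xs : List A} → Unique xs →
                   ∀ {i j} → lookup xs i ≡ lookup xs j → i ≡ j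
lookup-injective (_   ∷ _) {zero}  {zero}  _  = refl
lookup-injective (x∉  ∷ _) {zero}  {suc j} eq = contradiction eq (All.lookup x∉ (∈-lookup j))
lookup-injective (x∉  ∷ _) {suc i} {zero}  eq = contradiction (sym eq) (All.lookup x∉ (∈-lookup i))
lookup-injective (_   ∷ u) {suc i} {suc j} eq = cong suc (lookup-injective u eq)

module _ {A : Set} (_≟_ : DecidableEquality A) where
  open DecMembership _≟_ using (_∈?_)

  members-finite : (xs : List A) → Finite (Refinement A (_∈ xs))
  members-finite xs = length ys , mk↔ₛ′ to from to∘from (λ x → value-injective (from∘to x))
    where
    ys = deduplicate _≟_ xs

    position : (x : Refinement A (_∈ xs)) → value x ∈ ys
    -- The membership proof stored in a `Refinement` is irrelevant; deciding membership again yields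
    -- one that can be computed with.
    position (x , [ x∈xs ]) = ∈-deduplicate⁺ _≟_ (recompute (x ∈? xs) x∈xs)

    to : Refinement A (_∈ xs) → Fin (length ys)
    to x = index (position x)

    from : Fin (length ys) → Refinement A (_∈ xs)
    from i = lookup ys i , [ ∈-deduplicate⁻ _≟_ xs (∈-lookup i) ]

    from∘to : ∀ x → value (from (to x)) ≡ value x
    from∘to x = sym (lookup-index (position x))

    to∘from : ∀ i → to (from i) ≡ i
    -- `ys` has no repetitions, so positions with equal entries coincide and `from∘to` suffices.
    to∘from i = lookup-injective (deduplicate-! _≟_ xs) (from∘to (from i))

module _ (G : Graph) where
  private
    V = Vertex G

  -- Folding w onto v is a homomorphic retraction of w ∷ xs onto xs.
  -- If w already lies in xs, the resulting transition is trivial.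
  data _⟶_ (xs : List V) : List V → Set where
    add : ∀ {w v} → v ∈ xs → Adj G w v →
          (∀ {x} → x ∈ xs → Adj G w x → Adj G v x) → xs ⟶ (w ∷ xs)

  ⟶⇒⊆ : ∀ {xs ys} → xs ⟶ ys → ∀ {x} → x ∈ xs → x ∈ ys
  ⟶⇒⊆ (add _ _ _) = there

  module _ (_≟_ : DecidableEquality V) where
    open DecMembership _≟_ using (_∈?_)

    module Fold {w v : V} {xs : List V} (v∈xs : v ∈ xs) (w~v : Adj G w v)
                (dominates : ∀ {x} → x ∈ xs → Adj G w x → Adj G v x) where

      small = induced G (_∈ xs)
      large = induced G (_∈ (w ∷ xs))

      include : Vertex small → Vertex large
      include = refine there

      -- The test is membership in `xs`, not equality with `w`: a `w` already in `xs` has to stay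
      -- fixed for `fold` to be a retraction.
      fold : Vertex large → Vertex small
      fold (x , _) with x ∈? xs
      ... | yes x∈xs = x , [ x∈xs ]
      ... | no  _    = v , [ v∈xs ]

      outside≡w : (x : Vertex large) → value x ∉ xs → value x ≡ w
      outside≡w (x , [ x∈ ]) x∉xs = recompute (x ≟ w) (head x∉xs x∈)

      fold-include : ∀ x → fold (include x) ≡ x
      fold-include (x , [ x∈xs ]) with x ∈? xs
      ... | yes _    = refl
      ... | no  x∉xs = contradiction-irr x∈xs x∉xs

      -- If exactly one endpoint lies outside `xs`, it is `w` and moves to `v`, so `dominates` gives
      -- the edge. If both do, both move to `v`, which has a loop.
      fold-homomorphism : IsHomomorphism large small fold
      fold-homomorphism {x , px} {y , py} x~y with x ∈? xs | y ∈? xs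
      ... | yes _    | yes _    = x~y
      ... | yes x∈xs | no  y∉xs with refl ← outside≡w (y , py) y∉xs =
        Graph.sym G (dominates x∈xs (Graph.sym G x~y))
      ... | no  x∉xs | yes y∈xs with refl ← outside≡w (x , px) x∉xs =
        dominates y∈xs x~y
      ... | no  _    | no  _    = Graph.refl G

      w~fold-w : ∀ pw → Adj G w (value (fold (w , pw)))
      w~fold-w _ with w ∈? xs
      ... | yes _ = Graph.refl G
      ... | no  _ = w~v

      remaining∉xs : ∀ x → ∁ (Image include) x → value x ∉ xs
      remaining∉xs (x , _) x∉image x∈xs = x∉image ((x , [ x∈xs ]) , refl)

      apart : w ∉ xs → ∁ (Image include) ≐ ｛ w , [ here refl ] ｝
      apart w∉xs =
          (λ {x} x∉image → value-injective (sym (outside≡w x (remaining∉xs x x∉image))))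
        , λ { refl ((_ , [ w∈xs ]) , refl) → contradiction-irr w∈xs w∉xs }

      absorbed : w ∈ xs → Trivial small large include fold
      absorbed w∈xs x x∉image = x∉xs (subst (_∈ xs) (sym (outside≡w x x∉xs)) w∈xs)
        where x∉xs = remaining∉xs x x∉image

      remainder : Trivial small large include fold ⊎
                  (∃[ u ] (∁ (Image include) ≐ ｛ u ｝ × Adj large u (include (fold u))))
      remainder with w ∈? xs
      ... | yes w∈xs = inj₁ (absorbed w∈xs)
      ... | no  w∉xs = inj₂ (_ , apart w∉xs , w~fold-w [ here refl ])

      sociableTransition : IsSociableTransition small large include fold
      sociableTransition = record
        { transition = record
          { finite       = members-finite _≟_ xs
          ; nonempty     = v , [ v∈xs ]
          ; embedding    = record
            { homomorphism = id
            ; injective    = λ eq → value-injective (cong value eq)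
            ; reflects     = id
            }
          ; homomorphism = λ {x} {y} → fold-homomorphism {x} {y}
          ; retraction   = fold-include
          ; remainder    = map₂ (λ (u , apart , _) → u , apart) remainder
          }
        ; sociable   = remainder
        }

    ⟶⇒sociable : ∀ {xs ys} (step : xs ⟶ ys) →
                 ∃ (IsSociableTransition (induced G (_∈ xs)) (induced G (_∈ ys))
                                         (refine (⟶⇒⊆ step)))
    ⟶⇒sociable (add v∈xs w~v dominates) = fold , sociableTransition
      where open Fold v∈xs w~v dominates

  record Cone : Set where
    field
      base      : List V
      apex      : V
      apex∈base : apex ∈ base
      apex~base : ∀ {x} → x ∈ base → Adj G apex x

  open Cone

  singleton : V → Cone
  singleton v = record
    { base      = v ∷ []
    ; apex      = v
    ; apex∈base = here refl
    ; apex~base = λ { (here refl) → Graph.refl G }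
    }

  replaceApex : (C : Cone) {z : V} → (∀ {x} → x ∈ base C → Adj G z x) → Cone
  replaceApex C {z} z~base = record
    { base      = z ∷ base C
    ; apex      = z
    ; apex∈base = here refl
    ; apex~base = λ { (here refl) → Graph.refl G ; (there x∈) → z~base x∈ }
    }

  absorb : (C : Cone) {r : V} → Adj G (apex C) r → Cone
  absorb C {r} apex~r = record
    { base      = r ∷ base C
    ; apex      = apex C
    ; apex∈base = there (apex∈base C)
    ; apex~base = λ { (here refl) → apex~r ; (there x∈) → apex~base C x∈ }
    }

  -- Folding onto the apex makes domination automatic, since the apex is adjacent to the whole base.
  cone⟶ : (C : Cone) {w : V} → Adj G (apex C) w → base C ⟶ (w ∷ base C)
  cone⟶ C apex~w = add (apex∈base C) (Graph.sym G apex~w) (λ x∈ _ → apex~base C x∈)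

  module Exhaustion
    (universal : (xs : List V) → ∃[ z ] (∀ {x} → x ∈ xs → Adj G z x))
    (enum : ℕ → V) where

    prepare : V → Cone → Cone
    -- The common neighbour is taken for `r` and the base together: `there` keeps the part about the
    -- base, and `prepared` uses the part about `r`.
    prepare r C = replaceApex C (proj₂ (universal (r ∷ base C)) ∘ there)

    prepared : ∀ r C → Adj G (apex (prepare r C)) r
    prepared r C = proj₂ (universal (r ∷ base C)) (here refl)

    even odd : ℕ → Cone
    -- The first round lists `enum zero` once more, which gives a trivial transition.
    even zero    = singleton (enum zero)
    even (suc k) = absorb (prepare (enum k) (even k)) (prepared (enum k) (even k))
    odd k = prepare (enum k) (even k)

    even⟶odd : ∀ k → base (even k) ⟶ base (odd k)
    -- The old apex lies in the base of `odd k`, so the new apex is adjacent to it and can fold onto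
    -- it.
    even⟶odd k = cone⟶ (even k) (Graph.sym G (apex~base (odd k) (there (apex∈base (even k)))))

    odd⟶even : ∀ k → base (odd k) ⟶ base (even (suc k))
    odd⟶even k = cone⟶ (odd k) (prepared (enum k) (even k))

    -- `k` counts completed rounds and `n` the further single steps. Recursion by two lets
    -- `interleave⟶` reduce to the two kinds of step without parity arithmetic.
    interleave : ℕ → ℕ → List V
    interleave k zero          = base (even k)
    interleave k (suc zero)    = base (odd k)
    interleave k (suc (suc n)) = interleave (suc k) n

    interleave⟶ : ∀ k n → interleave k n ⟶ interleave k (suc n)
    interleave⟶ k zero          = even⟶odd k
    interleave⟶ k (suc zero)    = odd⟶even k
    interleave⟶ k (suc (suc n)) = interleave⟶ (suc k) n

    interleave-even : ∀ k n → interleave k (n * 2) ≡ base (even (n + k))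
    interleave-even k zero    = refl
    interleave-even k (suc n) =
      trans (interleave-even (suc k) n) (cong (base ∘ even) (+-suc n k))

    stage : ℕ → List V
    stage = interleave zero

    enum∈stage : ∀ k → enum k ∈ stage (suc k * 2)
    enum∈stage k = subst (enum k ∈_) (sym (interleave-even zero (suc k)))
      -- `enum k` is the head of `base (even (suc k))`, the vertex absorbed last in that round.
      (subst (λ j → enum k ∈ base (even (suc j))) (sym (+-identityʳ k)) (here refl))

module _ (R : Graph) (isRandom : IsRandomGraph R) where
  open IsRandomGraph isRandom

  random-universal : (xs : List (Vertex R)) → ∃[ z ] (∀ {x} → x ∈ xs → Adj R z x)
  random-universal xs = let z , _ , z~xs , _ = extension xs [] (λ { (_ , ()) }) in z , z~xs

  -- The extension property, applied to a list of all vertices, would give a vertex outside that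
  -- list.
  random-infinite : ¬ Finite (Vertex R)
  random-infinite (n , V↔Fin) =
    let z , z∉ , _ = extension (tabulate from) [] (λ { (_ , ()) })
    in z∉ (∈-++⁺ˡ (subst (_∈ tabulate from) (strictlyInverseʳ z) (∈-tabulate⁺ (to z))))
    where open Inverse V↔Fin

  random↔ℕ : Vertex R ↔ ℕ
  random↔ℕ with countable
  ... | inj₁ finite = contradiction finite random-infinite
  ... | inj₂ V↔ℕ    = V↔ℕ

corollary7p2 : (R : Graph) → IsRandomGraph R → Sociable R
corollary7p2 R isRandom = record
  { countable = IsRandomGraph.countable isRandom
  ; S         = λ n → _∈ stage n
  ; start     = from zero , (λ { (here refl) → refl }) , (λ { refl → here refl })
  ; S⊆S       = λ n → ⟶⇒⊆ R (interleave⟶ zero n)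
  -- Decidable equality of vertices is pulled back from `ℕ` along the enumeration.
  ; step      = λ n → ⟶⇒sociable R (via-injection (↔⇒↣ V↔ℕ) _≟ℕ_) (interleave⟶ zero n)
  ; union     = λ v → suc (to v) * 2
                    , subst (_∈ stage (suc (to v) * 2)) (strictlyInverseʳ v) (enum∈stage (to v))
  }
  where
  V↔ℕ = random↔ℕ R isRandom
  open Inverse V↔ℕ
  open Exhaustion R (random-universal R isRandom) from
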